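{- Consider the indivisible coflow scheduling problem on $m\ge1$ identical parallel network cores in the special case when all coflows are released at time zero ($r_k=0$ for all $k\in\mathcal K$). The algorithm coflow-driven-list-scheduling (defined in the context) has approximation ratio at most $4m$. That is, for every such instance, the schedule it produces has coflow completion times $\tilde C_k$ ($k\in\mathcal K$) satisfying $$\sum_{k\in\mathcal K} w_k\tilde C_k\le 4m\,\mathrm{OPT},$$ where $\mathrm{OPT}$ is the minimum of $\sum_{k\in\mathcal K} w_kC_k$ over all feasible indivisible schedules of the instance.
   Context: Network: there are $m$ identical cores $h=1,\dots,m$. Each core is a non-blocking $N\times N$ switch with input ports $\mathcal I=\{1,\dots,N\}$ and output ports $\mathcal J=\{1,\dots,N\}$. Every port of every core has capacity (rate) $1$. Instance: a finite set $\mathcal K$ of coflows. Coflow $k$ has a release time $r_k\ge 0$, a weight $w_k>0$, and a demand matrix $(d_{ijk})_{i,j=1}^N$ of non-negative integers. Each triple $(i,j,k)$ with $d_{ijk}>0$ is a flow of size $d_{ijk}$ that must be sent from input $i$ to output $j$, and not before time $r_k$. Put $L_{ik}=\sum_{j=1}^N d_{ijk}$ for an input $i$ and $L_{jk}=\sum_{i=1}^N d_{ijk}$ for an output $j$. Feasible indivisible schedule: each coflow is assigned to exactly one core, and all its flows are transmitted through that core. Preemption is allowed. At any time, on each core, the total transmission rate through each input port and through each output port is at most $1$. The completion time $C_k$ of coflow $k$ is the time at which all its flows are finished (with $C_k=r_k$ if it has no flows). The objective is to minimize $\sum_k w_kC_k$. Linear program: minimize $\sum_{k}w_kC_k$ over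 variables $C_k$ ($k\in\mathcal K$) subject to - $C_k\ge r_k+L_{ik}$ for all $k\in\mathcal K$, $i\in\mathcal I$, and $C_k\ge r_k+L_{jk}$ for all $k\in\mathcal K$, $j\in\mathcal J$; - $\sum_{k\in S}L_{ik}C_k\ge\frac1{2m}\left(\sum_{k\in S}L_{ik}^2+\left(\sum_{k\in S}L_{ik}\right)^2\right)$ for all $i\in\mathcal I$, $S\subseteq\mathcal K$; - $\sum_{k\in S}L_{jk}C_k\ge\frac1{2m}\left(\sum_{k\in S}L_{jk}^2+\left(\sum_{k\in S}L_{jk}\right)^2\right)$ for all $j\in\mathcal J$, $S\subseteq\mathcal K$. Algorithm coflow-driven-list-scheduling: compute an optimal LP solution, and list the coflows as $1,\dots,n$ so that $\bar C_1\le\dots\le\bar C_n$ (ties broken arbitrarily). Phase 1 (assignment): initialize all $load_I(i,h)=load_O(j,h)=0$. For $k=1,\dots,n$ in order, assign coflow $k$ to a core $h^*$ minimizing over $h$ the quantity $\max_{i,j\in[1,N]}\left(load_I(i,h)+load_O(j,h)+L_{ik}+L_{jk}\right)$. Then increase $load_I(i,h^*)$ by $L_{ik}$ and $load_O(j,h^*)$ by $L_{jk}$ for all $i,j$. Phase 2 (transmission): on each core $h$ independently, starting when the first coflow is released, and at every time a flow is released or completed, recompute the set of active flows. To do so, scan the released, incomplete flows of the coflows assigned to $h$, in the list order of their coflows (in an arbitrary order within a coflow), and make a flow from $i$ to $j$ active if neither input port $i$ nor output port $j$ of core $h$ is used by a flow already made active in this scan. Active flows are transmitted at rate $1$ until the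 next release or completion event. -}

module Defs where

open import Algebra.Bundles using (CommutativeRing)
open import Algebra.Core using (Op₁; Op₂)
open import Algebra.Structures using (IsCommutativeRing)
import Algebra.Properties.Monoid.Mult as Mult
import Algebra.Properties.Monoid.Sum as Sum
open import Data.Bool.Base using (if_then_else_)
open import Data.Fin.Base using (Fin)
open import Data.Fin.Properties using (_≟_)
open import Data.Fin.Subset using (Subset)
open import Data.List.Base as List using (List; []; _∷_; allFin; cartesianProduct; concatMap; filter)
open import Data.List.Membership.Propositional using (_∈_)
import Data.List.Membership.DecPropositional as DecMembership
open import Data.List.Relation.Binary.Permutation.Propositional using (_↭_)
open import Data.List.Relation.Unary.AllPairs using (AllPairs)
open import Data.List.Relation.Unary.Any using (any?)
open import Data.Nat.Base as ℕ using (ℕ)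
import Data.Nat.Properties as ℕ
open import Data.Product.Base using (_×_; _,_; ∃; ∃-syntax)
open import Data.Product.Properties using (≡-dec)
open import Data.Sum.Base using (_⊎_)
open import Data.Vec.Base using (lookup)
import Data.Vec.Functional as Vector
open import Level using (_⊔_; suc)
open import Relation.Binary.Bundles using (DecTotalOrder)
open import Relation.Binary.Core using (Rel)
open import Relation.Binary.Definitions using (Decidable; DecidableEquality)
import Relation.Binary.Construct.NonStrictToStrict as ToStrict
open import Relation.Binary.PropositionalEquality.Core using (_≡_)
open import Relation.Binary.Structures using (IsDecTotalOrder)
open import Relation.Nullary.Decidable.Core using (does; _×-dec_; _⊎-dec_)
open import Relation.Nullary.Negation.Core using (¬_)

-- Times, weights and amounts of transmitted data take values in an arbitrary
-- linearly ordered field, of which ℝ (classically) and ℚ are instances.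

record OrderedField c ℓ₁ ℓ₂ : Set (suc (c ⊔ ℓ₁ ⊔ ℓ₂)) where
  infix  9 _⁻¹
  infix  8 -_
  infixl 7 _*_
  infixl 6 _+_
  infix  4 _≈_ _≤_ _<?_
  field
    Carrier           : Set c
    _≈_               : Rel Carrier ℓ₁
    _≤_               : Rel Carrier ℓ₂
    _+_ _*_           : Op₂ Carrier
    -_                : Op₁ Carrier
    0# 1#             : Carrier
    -- Total for convenience; the value at 0# is unspecified.
    _⁻¹               : Op₁ Carrier
    isCommutativeRing : IsCommutativeRing _≈_ _+_ _*_ -_ 0# 1#
    isDecTotalOrder   : IsDecTotalOrder _≈_ _≤_
    0≉1               : ¬ (0# ≈ 1#)
    ⁻¹-inverseʳ       : ∀ x → ¬ (x ≈ 0#) → x * x ⁻¹ ≈ 1#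
    +-monoˡ-≤         : ∀ z {x y} → x ≤ y → x + z ≤ y + z
    *-nonNegative     : ∀ {x y} → 0# ≤ x → 0# ≤ y → 0# ≤ x * y

  commutativeRing : CommutativeRing c ℓ₁
  commutativeRing = record { isCommutativeRing = isCommutativeRing }

  decTotalOrder : DecTotalOrder c ℓ₁ ℓ₂
  decTotalOrder = record { isDecTotalOrder = isDecTotalOrder }

  open CommutativeRing commutativeRing public using (_-_; +-monoid)
  open DecTotalOrder decTotalOrder public using (_≤?_) renaming (_≟_ to _≈?_)
  open ToStrict _≈_ _≤_ public using (_<_)

  _<?_ : Decidable _<_
  _<?_ = ToStrict.<-decidable _≈_ _≤_ _≈?_ _≤?_

  open Sum +-monoid public using (sum)

  fromℕ : ℕ → Carrier
  fromℕ n = n · 1#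
    where open Mult +-monoid renaming (_×_ to _·_)

open Sum ℕ.+-0-monoid public using () renaming (sum to sumℕ)

maxℕ : ∀ {n} → (Fin n → ℕ) → ℕ
maxℕ = Vector.foldr ℕ._⊔_ 0

module CoflowScheduling
  {c ℓ₁ ℓ₂} (F : OrderedField c ℓ₁ ℓ₂)
  (N m : ℕ)
  where

  open OrderedField F

  Time : Set c
  Time = Carrier

  Core : Set
  Core = Fin m

  Port : Set
  Port = Fin N

  record Instance : Set (c ⊔ ℓ₁ ⊔ ℓ₂) where
    field
      n         : ℕ
      release   : Fin n → Time
      release≥0 : ∀ k → 0# ≤ release k
      weight    : Fin n → Carrier
      weight>0  : ∀ k → 0# < weight k
      demand    : Port → Port → Fin n → ℕ

  module _ (I : Instance) where
    open Instance I

    Coflow : Set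
    Coflow = Fin n

    -- Triples of zero demand are allowed here, but never have anything to
    -- send.
    Flow : Set
    Flow = Port × Port × Coflow

    size : Flow → ℕ
    size (i , j , k) = demand i j k

    coflow : Flow → Coflow
    coflow (i , j , k) = k

    inputLoad : Port → Coflow → ℕ
    inputLoad i k = sumℕ (λ j → demand i j k)

    outputLoad : Port → Coflow → ℕ
    outputLoad j k = sumℕ (λ i → demand i j k)

    cost : (Coflow → Time) → Carrier
    cost C = sum (λ k → weight k * C k)

    -- A schedule is given by the amount  sent f t  of flow f transmitted up to
    -- time t, that is, by the integral of the transmission rate of f.
    record Schedule : Set c where
      field
        core : Coflow → Core
        sent : Flow → Time → Carrier

    module _ (σ : Schedule) where
      open Schedule σ

      sentBetween : Time → Time → Flow → Carrier
      sentBetween s t f = sent f t - sent f s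

      inputTraffic : Core → Port → Time → Time → Carrier
      inputTraffic h i s t = sum (λ j → sum (λ k →
        if does (core k ≟ h) then sentBetween s t (i , j , k) else 0#))

      outputTraffic : Core → Port → Time → Time → Carrier
      outputTraffic h j s t = sum (λ i → sum (λ k →
        if does (core k ≟ h) then sentBetween s t (i , j , k) else 0#))

      -- The rates through a port are bounded by 1 at (almost) all times
      -- exactly when the traffic during every interval is bounded by the
      -- length of the interval; rates need not be piecewise constant.
      record Feasible : Set (c ⊔ ℓ₁ ⊔ ℓ₂) where
        field
          notBeforeRelease : ∀ f t → t ≤ release (coflow f) → sent f t ≈ 0#
          monotone         : ∀ f {s t} → s ≤ t → sent f s ≤ sent f t
          bounded          : ∀ f t → sent f t ≤ fromℕ (size f)
          inputCapacity    : ∀ h i {s t} → s ≤ t → inputTraffic h i s t ≤ t - s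
          outputCapacity   : ∀ h j {s t} → s ≤ t → outputTraffic h j s t ≤ t - s

      Finished : Coflow → Time → Set ℓ₁
      Finished k t = ∀ i j → sent (i , j , k) t ≈ fromℕ (demand i j k)

      record IsCompletionTime (k : Coflow) (C : Time) : Set (c ⊔ ℓ₁ ⊔ ℓ₂) where
        field
          afterRelease : release k ≤ C
          finished     : Finished k C
          earliest     : ∀ t → release k ≤ t → Finished k t → C ≤ t

    sumOver : Subset n → (Coflow → Carrier) → Carrier
    sumOver S x = sum (λ k → if lookup S k then x k else 0#)

    LoadInequality : (Coflow → ℕ) → (Coflow → Carrier) → Subset n → Set ℓ₂
    LoadInequality load C S =
      fromℕ (2 ℕ.* m) ⁻¹ * (sumOver S (λ k → L k * L k) + sumOver S L * sumOver S L)
        ≤ sumOver S (λ k → L k * C k)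
      where
      L : Coflow → Carrier
      L k = fromℕ (load k)

    record LPFeasible (C : Coflow → Carrier) : Set (c ⊔ ℓ₁ ⊔ ℓ₂) where
      field
        inputBound       : ∀ k i → release k + fromℕ (inputLoad i k) ≤ C k
        outputBound      : ∀ k j → release k + fromℕ (outputLoad j k) ≤ C k
        inputInequality  : ∀ i S → LoadInequality (inputLoad i) C S
        outputInequality : ∀ j S → LoadInequality (outputLoad j) C S

    record LPOptimal (C : Coflow → Carrier) : Set (c ⊔ ℓ₁ ⊔ ℓ₂) where
      field
        feasible : LPFeasible C
        optimal  : ∀ C′ → LPFeasible C′ → cost C ≤ cost C′

    record Loads : Set where
      field
        loadI : Port → Core → ℕ
        loadO : Port → Core → ℕ

    emptyLoads : Loads
    emptyLoads = record { loadI = λ _ _ → 0 ; loadO = λ _ _ → 0 }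

    addCoflow : Loads → Coflow → Core → Loads
    addCoflow ℓ k h* = record
      { loadI = λ i h → if does (h ≟ h*) then loadI i h ℕ.+ inputLoad i k else loadI i h
      ; loadO = λ j h → if does (h ≟ h*) then loadO j h ℕ.+ outputLoad j k else loadO j h
      }
      where open Loads ℓ

    maxLoad : Loads → Coflow → Core → ℕ
    maxLoad ℓ k h = maxℕ (λ i → maxℕ (λ j →
      loadI i h ℕ.+ loadO j h ℕ.+ inputLoad i k ℕ.+ outputLoad j k))
      where open Loads ℓ

    -- Assigns core ℓ ks: starting from loads ℓ, the coflows in ks can be
    -- assigned greedily, in this order, to the cores given by the function core.
    data Assigns (core : Coflow → Core) : Loads → List Coflow → Set where
      []  : ∀ {ℓ} → Assigns core ℓ []
      _∷_ : ∀ {ℓ k ks} →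
            (∀ h → maxLoad ℓ k (core k) ℕ.≤ maxLoad ℓ k h) →
            Assigns core (addCoflow ℓ k (core k)) ks →
            Assigns core ℓ (k ∷ ks)

    _≟-flow_ : DecidableEquality Flow
    _≟-flow_ = ≡-dec _≟_ (≡-dec _≟_ _≟_)

    open DecMembership _≟-flow_ using (_∈?_)

    Conflict : Flow → Flow → Set
    Conflict (i , j , _) (i′ , j′ , _) = i ≡ i′ ⊎ j ≡ j′

    conflict? : Decidable Conflict
    conflict? (i , j , _) (i′ , j′ , _) = (i ≟ i′) ⊎-dec (j ≟ j′)

    scan : List Flow → List Flow → List Flow
    scan active []       = active
    scan active (f ∷ fs) =
      if does (any? (conflict? f) active) then scan active fs else scan (f ∷ active) fs

    portPairs : List (Port × Port)
    portPairs = cartesianProduct (allFin N) (allFin N)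

    module Transmission (core : Coflow → Core) (order : List Coflow) (h : Core) where

      -- An order of the flows inside each coflow.
      Arrangement : Set
      Arrangement = ∃ λ (arr : Coflow → List (Port × Port)) → ∀ k → arr k ↭ portPairs

      listing : Arrangement → List Flow
      listing (arr , _) = concatMap (λ k → List.map (λ (i , j) → i , j , k) (arr k)) order

      -- The flows made active at time t, when rem f is what remains of flow f.
      activate : Arrangement → Time → (Flow → Carrier) → List Flow
      activate a t rem = scan [] (filter
        (λ f → (core (coflow f) ≟ h) ×-dec ((release (coflow f) ≤? t) ×-dec (0# <? rem f)))
        (listing a))

      -- Events after time t, if the flows in A are transmitted from t on.
      data Event (t : Time) (rem : Flow → Carrier) (A : List Flow) (e : Time)
           : Set (c ⊔ ℓ₁ ⊔ ℓ₂) where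
        completion : ∀ f → f ∈ A → e ≈ t + rem f → Event t rem A e
        arrival    : ∀ f → core (coflow f) ≡ h → 0 ℕ.< size f →
                     t < release (coflow f) → e ≈ release (coflow f) → Event t rem A e

      record NextEvent (t : Time) (rem : Flow → Carrier) (A : List Flow) (e : Time)
             : Set (c ⊔ ℓ₁ ⊔ ℓ₂) where
        field
          event : Event t rem A e
          first : ∀ e′ → Event t rem A e′ → e ≤ e′

      transmit : Time → List Flow → (Flow → Carrier) → Flow → Carrier
      transmit Δ A rem f = if does (f ∈? A) then rem f - Δ else rem f

      -- Executions on core h from time t on, when rem f remains of flow f.
      data Run (t : Time) (rem : Flow → Carrier) : Set (c ⊔ ℓ₁ ⊔ ℓ₂) where
        done : (∀ f → core (coflow f) ≡ h → rem f ≈ 0#) → Run t rem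
        step : (a : Arrangement) (t′ : Time) → let A = activate a t rem in
               NextEvent t rem A t′ → Run t′ (transmit (t′ - t) A rem) → Run t rem

      data CoreRun : Set (c ⊔ ℓ₁ ⊔ ℓ₂) where
        idle  : (∀ k → ¬ (core k ≡ h)) → CoreRun
        start : ∀ t₀ → (∃[ k ] core k ≡ h × t₀ ≈ release k) →
                (∀ k → core k ≡ h → t₀ ≤ release k) →
                Run t₀ (λ f → fromℕ (size f)) → CoreRun

      -- The part of the interval from a to b that lies before time s.
      elapsed : Time → Time → Time → Carrier
      elapsed a b s =
        if does (s ≤? a) then 0# else (if does (s ≤? b) then s - a else b - a)

      sentInRun : ∀ {t rem} → Run t rem → Flow → Time → Carrier
      sentInRun (done _) f s = 0#
      sentInRun {t} {rem} (step a t′ _ run) f s =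
        (if does (f ∈? activate a t rem) then elapsed t t′ s else 0#) + sentInRun run f s

      sentOnCore : CoreRun → Flow → Time → Carrier
      sentOnCore (idle _)          f s = 0#
      sentOnCore (start _ _ _ run) f s = sentInRun run f s

    -- An execution of coflow-driven-list-scheduling, with all its arbitrary
    -- choices.
    record Execution : Set (c ⊔ ℓ₁ ⊔ ℓ₂) where
      field
        C̄          : Coflow → Carrier
        C̄-optimal  : LPOptimal C̄
        order      : List Coflow
        order-↭    : order ↭ allFin n
        sorted     : AllPairs (λ k l → C̄ k ≤ C̄ l) order
        core       : Coflow → Core
        assignment : Assigns core emptyLoads order
        runs       : ∀ h → Transmission.CoreRun core order h

      schedule : Schedule
      schedule = record
        { core = core
        ; sent = λ f → Transmission.sentOnCore core order (core (coflow f)) (runs (core (coflow f))) f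
        }

{-# OPTIONS --safe #-}

-- The greedy assignment plays no role: the total load over all cores already
-- suffices.  On its core, a flow of coflow k is at every time transmitted or
-- blocked by a flow through one of its two ports that belongs to a coflow l
-- with C̄ l ≤ C̄ k, so it is finished once the time exceeds the total load
-- X_i + X_j of these coflows on its ports.  The LP inequality for the set of
-- these coflows gives X² ≤ 2m X C̄ k for either port, hence C̃ k ≤ 4m C̄ k.  The
-- completion times of every feasible schedule satisfy the LP constraints, so
-- the LP optimum is at most the optimal cost.

module Submission where

open import Defs
open import Algebra.Bundles using (CommutativeRing)
import Algebra.Properties.Group as GroupProperties
import Algebra.Properties.Semiring.Mult as SemiringMult
import Algebra.Properties.Semiring.Sum as SemiringSum
import Algebra.Solver.Ring.NaturalCoefficients.Default as NatSolver
open import Data.Bool.Base using (Bool; true; false; if_then_else_; _∧_)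
open import Data.Fin.Base using (Fin; zero; suc)
open import Data.Fin.Properties using (_≟_)
open import Data.Fin.Subset using (Subset)
open import Data.List.Base as List using (List; []; _∷_)
import Data.List.Membership.DecPropositional as DecMembership
open import Data.List.Membership.Propositional using (_∈_; lose; find)
open import Data.List.Membership.Propositional.Properties
  using (∈-filter⁺; ∈-filter⁻; ∈-concatMap⁺; ∈-map⁺; ∈-allFin; ∈-cartesianProduct⁺)
open import Data.List.Relation.Binary.Permutation.Propositional using (_↭_; ↭-sym)
open import Data.List.Relation.Binary.Permutation.Propositional.Properties using (∈-resp-↭)
open import Data.List.Relation.Unary.All as All using ([]; _∷_)
import Data.List.Relation.Unary.All.Properties as All
open import Data.List.Relation.Unary.AllPairs as AllPairs using (AllPairs; []; _∷_)
import Data.List.Relation.Unary.AllPairs.Properties as AllPairs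
open import Data.List.Relation.Unary.Any using (here; there; any?)
open import Data.Nat.Base as ℕ using (ℕ; zero; suc; NonZero) renaming (_*_ to _*ℕ_)
import Data.Nat.Properties as ℕ
open import Data.Product.Base using (_×_; _,_; proj₁; proj₂; ∃-syntax)
open import Data.Sum.Base using (_⊎_; inj₁; inj₂)
open import Data.Vec.Base using (lookup; tabulate)
open import Data.Vec.Properties using (lookup∘tabulate)
open import Function.Base using (_∘_)
open import Relation.Binary.Bundles using (DecTotalOrder)
open import Relation.Binary.PropositionalEquality.Core as ≡ using (_≡_)
import Relation.Binary.Reasoning.PartialOrder as PartialOrderReasoning
open import Relation.Nullary.Decidable using (_×-dec_; yes; no; does; dec-true; dec-false)
open import Relation.Nullary.Negation.Core using (¬_; contradiction)

-- Arithmetic in a linearly ordered field.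

module OrderedFieldProperties {c ℓ₁ ℓ₂} (F : OrderedField c ℓ₁ ℓ₂) where

  open OrderedField F public
  open CommutativeRing commutativeRing public using
    ( semiring; commutativeSemiring; +-group
    ; refl; sym; trans; reflexive; +-cong; +-congˡ; +-congʳ; +-comm; +-assoc; +-identityˡ; +-identityʳ
    ; -‿inverseʳ; -‿cong; *-cong; *-congˡ; *-congʳ; *-comm; *-assoc; *-identityˡ
    ; distribˡ; distribʳ; zeroˡ; zeroʳ )
  open DecTotalOrder decTotalOrder public using (poset; total; antisym)
    renaming (refl to ≤-refl; trans to ≤-trans; reflexive to ≤-reflexive)
  open SemiringSum semiring public using
    (sum-cong-≋; sum-replicate-zero; ∑-distrib-+; ∑-comm; *-distribˡ-sum; *-distribʳ-sum)
  open SemiringMult semiring using (×-homo-+)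
  open GroupProperties +-group using (//-rightDividesˡ; //-rightDividesʳ; ε⁻¹≈ε)
  module ≤-Reasoning = PartialOrderReasoning poset
  open ≤-Reasoning
  open NatSolver commutativeSemiring using (solve; _:=_; _:+_; _:*_)

  private
    variable
      n : ℕ
      u v x y z : Carrier

  x-y+y≈x : ∀ x y → x - y + y ≈ x
  x-y+y≈x x y = //-rightDividesˡ y x

  y+[x-y]≈x : ∀ x y → y + (x - y) ≈ x
  y+[x-y]≈x x y = trans (+-comm y (x - y)) (x-y+y≈x x y)

  x-0≈x : ∀ x → x - 0# ≈ x
  x-0≈x x = trans (+-congˡ ε⁻¹≈ε) (+-identityʳ x)

  +-monoʳ-≤ : ∀ z → x ≤ y → z + x ≤ z + y
  +-monoʳ-≤ {x} {y} z x≤y = begin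
    z + x ≈⟨ +-comm z x ⟩
    x + z ≤⟨ +-monoˡ-≤ z x≤y ⟩
    y + z ≈⟨ +-comm y z ⟩
    z + y ∎

  +-mono-≤ : x ≤ y → u ≤ v → x + u ≤ y + v
  +-mono-≤ {x} {y} {u} {v} x≤y u≤v = ≤-trans (+-monoˡ-≤ u x≤y) (+-monoʳ-≤ y u≤v)

  +-cancelʳ-≤ : ∀ z → x + z ≤ y + z → x ≤ y
  +-cancelʳ-≤ {x} {y} z p = begin
    x         ≈⟨ //-rightDividesʳ z x ⟨
    x + z - z ≤⟨ +-monoˡ-≤ (- z) p ⟩
    y + z - z ≈⟨ //-rightDividesʳ z y ⟩
    y         ∎

  x≤x+y : 0# ≤ y → x ≤ x + y
  x≤x+y {y} {x} 0≤y = begin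
    x      ≈⟨ +-identityʳ x ⟨
    x + 0# ≤⟨ +-monoʳ-≤ x 0≤y ⟩
    x + y  ∎

  x≤y+x : 0# ≤ y → x ≤ y + x
  x≤y+x {y} {x} 0≤y = ≤-trans (x≤x+y 0≤y) (≤-reflexive (+-comm x y))

  +-nonNegative : 0# ≤ x → 0# ≤ y → 0# ≤ x + y
  +-nonNegative 0≤x 0≤y = ≤-trans 0≤x (x≤x+y 0≤y)

  x≤y⇒0≤y-x : x ≤ y → 0# ≤ y - x
  x≤y⇒0≤y-x {x} {y} x≤y = begin
    0#    ≈⟨ -‿inverseʳ x ⟨
    x - x ≤⟨ +-monoˡ-≤ (- x) x≤y ⟩
    y - x ∎

  -- Stands in for halving an inequality. In the case `y ≤ x`, `x + y` lies below `x + x`, hence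
  -- below `y + y`, and `y` cancels.
  x+x≤y+y⇒x≤y : x + x ≤ y + y → x ≤ y
  x+x≤y+y⇒x≤y {x} {y} p with total x y
  ... | inj₁ x≤y = x≤y
  ... | inj₂ y≤x = +-cancelʳ-≤ y (≤-trans (+-monoʳ-≤ x y≤x) p)

  *-monoˡ-≤ : ∀ z → 0# ≤ z → x ≤ y → z * x ≤ z * y
  *-monoˡ-≤ {x} {y} z 0≤z x≤y = begin
    z * x                   ≤⟨ x≤x+y (*-nonNegative 0≤z (x≤y⇒0≤y-x x≤y)) ⟩
    z * x + z * (y - x)     ≈⟨ distribˡ z x (y - x) ⟨
    z * (x + (y - x))       ≈⟨ *-congˡ (y+[x-y]≈x y x) ⟩
    z * y                   ∎

  *-monoʳ-≤ : ∀ z → 0# ≤ z → x ≤ y → x * z ≤ y * z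
  *-monoʳ-≤ {x} {y} z 0≤z x≤y = begin
    x * z ≈⟨ *-comm x z ⟩
    z * x ≤⟨ *-monoˡ-≤ z 0≤z x≤y ⟩
    z * y ≈⟨ *-comm z y ⟩
    y * z ∎

  square-nonNegative : ∀ x → 0# ≤ x * x
  square-nonNegative x with total 0# x
  ... | inj₁ 0≤x = *-nonNegative 0≤x 0≤x
  ... | inj₂ x≤0 = begin
    0#                  ≤⟨ *-nonNegative 0≤w 0≤w ⟩
    w * w               ≈⟨ +-identityˡ _ ⟨
    0# + w * w          ≈⟨ +-congʳ x*[x+w]≈0 ⟨
    -- The solver works over semirings, so the negative of `x` enters as a separate variable `w`.
    -- The identity holds for all `x` and `w`, and both products with the factor `x + w` vanish.
    x * (x + w) + w * w ≈⟨ solve 2 (λ x w → x :* (x :+ w) :+ w :* w := x :* x :+ (x :+ w) :* w) refl x w ⟩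
    x * x + (x + w) * w ≈⟨ +-congˡ (trans (*-congʳ x+w≈0) (zeroˡ w)) ⟩
    x * x + 0#          ≈⟨ +-identityʳ _ ⟩
    x * x               ∎
    where
    w = 0# - x
    0≤w : 0# ≤ w
    0≤w = x≤y⇒0≤y-x x≤0
    x+w≈0 : x + w ≈ 0#
    x+w≈0 = y+[x-y]≈x 0# x
    x*[x+w]≈0 : x * (x + w) ≈ 0#
    x*[x+w]≈0 = trans (*-congˡ x+w≈0) (zeroʳ x)

  -- The gap between the two sides is the square of `d = y - x`. Writing `y` as `x + d` keeps the
  -- identity free of subtraction.
  2xy≤x²+y² : ∀ x y → x * y + x * y ≤ x * x + y * y
  2xy≤x²+y² x y = begin
    x * y + x * y                     ≈⟨ +-cong (*-congˡ y≈x+d) (*-congˡ y≈x+d) ⟩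
    x * (x + d) + x * (x + d)         ≤⟨ x≤x+y (square-nonNegative d) ⟩
    x * (x + d) + x * (x + d) + d * d ≈⟨ solve 2 (λ x d → x :* (x :+ d) :+ x :* (x :+ d) :+ d :* d := x :* x :+ (x :+ d) :* (x :+ d)) refl x d ⟩
    x * x + (x + d) * (x + d)         ≈⟨ +-congˡ (*-cong y≈x+d y≈x+d) ⟨
    x * x + y * y                     ∎
    where
    d = y - x
    y≈x+d : y ≈ x + d
    y≈x+d = sym (y+[x-y]≈x y x)

  *-left-comm : ∀ x y z → x * (y * z) ≈ y * (x * z)
  *-left-comm = solve 3 (λ x y z → x :* (y :* z) := y :* (x :* z)) refl

  0≤1 : 0# ≤ 1#
  0≤1 = ≤-trans (square-nonNegative 1#) (≤-reflexive (*-identityˡ 1#))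

  -- The inverse equals `x` times its own square.
  ⁻¹-nonNegative : ¬ (x ≈ 0#) → 0# ≤ x → 0# ≤ x ⁻¹
  ⁻¹-nonNegative {x} x≉0 0≤x = begin
    0#                 ≤⟨ *-nonNegative 0≤x (square-nonNegative (x ⁻¹)) ⟩
    x * (x ⁻¹ * x ⁻¹)  ≈⟨ *-assoc _ _ _ ⟨
    x * x ⁻¹ * x ⁻¹    ≈⟨ *-congʳ (⁻¹-inverseʳ x x≉0) ⟩
    1# * x ⁻¹          ≈⟨ *-identityˡ _ ⟩
    x ⁻¹               ∎

  x⁻¹*[x*y]≈y : ¬ (x ≈ 0#) → x ⁻¹ * (x * y) ≈ y
  x⁻¹*[x*y]≈y {x} {y} x≉0 = begin-equality
    x ⁻¹ * (x * y) ≈⟨ solve 3 (λ i x y → i :* (x :* y) := x :* i :* y) refl (x ⁻¹) x y ⟩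
    x * x ⁻¹ * y   ≈⟨ *-congʳ (⁻¹-inverseʳ x x≉0) ⟩
    1# * y         ≈⟨ *-identityˡ y ⟩
    y              ∎

  x*[x⁻¹*y]≈y : ¬ (x ≈ 0#) → x * (x ⁻¹ * y) ≈ y
  x*[x⁻¹*y]≈y {x} {y} x≉0 = trans (*-left-comm x (x ⁻¹) y) (x⁻¹*[x*y]≈y x≉0)

  *-cancelˡ-≤ : ¬ (z ≈ 0#) → 0# ≤ z → z * x ≤ z * y → x ≤ y
  *-cancelˡ-≤ {z} {x} {y} z≉0 0≤z p = begin
    x              ≈⟨ x⁻¹*[x*y]≈y z≉0 ⟨
    z ⁻¹ * (z * x) ≤⟨ *-monoˡ-≤ (z ⁻¹) (⁻¹-nonNegative z≉0 0≤z) p ⟩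
    z ⁻¹ * (z * y) ≈⟨ x⁻¹*[x*y]≈y z≉0 ⟩
    y              ∎

  fromℕ-nonNegative : ∀ k → 0# ≤ fromℕ k
  fromℕ-nonNegative zero    = ≤-refl
  fromℕ-nonNegative (suc k) = +-nonNegative 0≤1 (fromℕ-nonNegative k)

  1≤fromℕ : ∀ k .{{_ : NonZero k}} → 1# ≤ fromℕ k
  1≤fromℕ (suc k) = x≤x+y (fromℕ-nonNegative k)

  -- An ordered field has characteristic zero: a vanishing positive numeral would squeeze `1#`
  -- between `0#` and `0#`.
  fromℕ≉0 : ∀ k .{{_ : NonZero k}} → ¬ (fromℕ k ≈ 0#)
  fromℕ≉0 k p = 0≉1 (antisym 0≤1 (≤-trans (1≤fromℕ k) (≤-reflexive p)))

  fromℕ-+ : ∀ j k → fromℕ (j ℕ.+ k) ≈ fromℕ j + fromℕ k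
  fromℕ-+ = ×-homo-+ 1#

  fromℕ-sumℕ : (f : Fin n → ℕ) → fromℕ (sumℕ f) ≈ sum (fromℕ ∘ f)
  fromℕ-sumℕ {zero}  f = refl
  fromℕ-sumℕ {suc n} f = trans (fromℕ-+ (f zero) _) (+-congˡ (fromℕ-sumℕ (f ∘ suc)))

  -- Terms guarded by Booleans, and finite sums.

  infix 9 ⟦_⟧_
  -- This unfolds to the very conditional used in `sumOver` and in the traffic sums, so these need
  -- no conversion.
  ⟦_⟧_ : Bool → Carrier → Carrier
  ⟦ b ⟧ x = if b then x else 0#

  ⟦⟧-cong : ∀ b → x ≈ y → ⟦ b ⟧ x ≈ ⟦ b ⟧ y
  ⟦⟧-cong true  p = p
  ⟦⟧-cong false p = refl

  ⟦⟧-mono-≤ : ∀ b → x ≤ y → ⟦ b ⟧ x ≤ ⟦ b ⟧ y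
  ⟦⟧-mono-≤ true  p = p
  ⟦⟧-mono-≤ false p = ≤-refl

  ⟦⟧-*-mono-≤ : ∀ b → (b ≡ true → x ≤ y) → 0# ≤ z → ⟦ b ⟧ (z * x) ≤ ⟦ b ⟧ z * y
  ⟦⟧-*-mono-≤ {z = z} true  p 0≤z = *-monoˡ-≤ z 0≤z (p ≡.refl)
  ⟦⟧-*-mono-≤ {y = y} false p 0≤z = ≤-reflexive (sym (zeroˡ y))

  ⟦⟧-nonNegative : ∀ b → 0# ≤ x → 0# ≤ ⟦ b ⟧ x
  ⟦⟧-nonNegative true  p = p
  ⟦⟧-nonNegative false p = ≤-refl

  ⟦⟧-≤ : ∀ b → 0# ≤ x → ⟦ b ⟧ x ≤ x
  ⟦⟧-≤ true  p = ≤-refl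
  ⟦⟧-≤ false p = p

  ⟦⟧-*ʳ : ∀ b x y → ⟦ b ⟧ x * y ≈ ⟦ b ⟧ (x * y)
  ⟦⟧-*ʳ true  x y = refl
  ⟦⟧-*ʳ false x y = zeroˡ y

  ⟦⟧-square : ∀ b x → ⟦ b ⟧ x * ⟦ b ⟧ x ≈ ⟦ b ⟧ (x * x)
  ⟦⟧-square true  x = refl
  ⟦⟧-square false x = zeroˡ 0#

  sum-mono-≤ : {f g : Fin n → Carrier} → (∀ i → f i ≤ g i) → sum f ≤ sum g
  sum-mono-≤ {zero}  p = ≤-refl
  sum-mono-≤ {suc n} p = +-mono-≤ (p zero) (sum-mono-≤ (p ∘ suc))

  sum-nonNegative : {f : Fin n → Carrier} → (∀ i → 0# ≤ f i) → 0# ≤ sum f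
  sum-nonNegative {zero}  p = ≤-refl
  sum-nonNegative {suc n} p = +-nonNegative (p zero) (sum-nonNegative (p ∘ suc))

  -- Slack at a single index survives summation. Later `z` is the length of a time step and `j`
  -- singles out a transmitted flow.
  sum-gain : {f g : Fin n → Carrier} → (∀ i → f i ≤ g i) →
             ∀ j → f j + z ≤ g j → sum f + z ≤ sum g
  sum-gain {z = z} {f} {g} p zero q = begin
    f zero + sum (f ∘ suc) + z ≈⟨ solve 3 (λ a b z → a :+ b :+ z := a :+ z :+ b) refl _ _ z ⟩
    f zero + z + sum (f ∘ suc) ≤⟨ +-mono-≤ q (sum-mono-≤ (p ∘ suc)) ⟩
    sum g                      ∎
  sum-gain {z = z} {f} {g} p (suc j) q = begin
    f zero + sum (f ∘ suc) + z   ≈⟨ +-assoc _ _ _ ⟩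
    f zero + (sum (f ∘ suc) + z) ≤⟨ +-mono-≤ (p zero) (sum-gain (p ∘ suc) j q) ⟩
    sum g                        ∎

  term≤sum : {f : Fin n → Carrier} → (∀ i → 0# ≤ f i) → ∀ j → f j ≤ sum f
  term≤sum {n} {f} p j = begin
    f j                    ≈⟨ +-identityˡ _ ⟨
    0# + f j               ≈⟨ +-congʳ (sum-replicate-zero n) ⟨
    sum {n} (λ _ → 0#) + f j ≤⟨ sum-gain p j (≤-reflexive (+-identityˡ _)) ⟩
    sum f                  ∎

  sum-⟦≟⟧ : (j : Fin n) (f : Fin n → Carrier) → sum (λ i → ⟦ does (j ≟ i) ⟧ f i) ≈ f j
  sum-⟦≟⟧ {suc n} zero    f = trans (+-congˡ (sum-replicate-zero n)) (+-identityʳ _)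
  sum-⟦≟⟧ {suc n} (suc j) f = trans (+-identityˡ _) (sum-⟦≟⟧ j (f ∘ suc))

  ⟦⟧-sum : ∀ b (f : Fin n → Carrier) → ⟦ b ⟧ sum f ≈ sum (λ i → ⟦ b ⟧ f i)
  ⟦⟧-sum     true  f = refl
  ⟦⟧-sum {n} false f = sym (sum-replicate-zero n)

  -- The quadratic inequalities behind the LP constraints.

  sum-*-sum : (f g : Fin n → Carrier) → sum f * sum g ≈ sum (λ i → sum (λ j → f i * g j))
  sum-*-sum f g = trans (*-distribʳ-sum (sum g) f) (sum-cong-≋ (λ i → *-distribˡ-sum (f i) g))

  sum-const : ∀ n x → sum {n} (λ _ → x) ≈ fromℕ n * x
  sum-const zero    x = sym (zeroˡ x)
  sum-const (suc n) x = trans (+-cong (sym (*-identityˡ x)) (sum-const n x)) (sym (distribʳ x 1# (fromℕ n)))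

  -- Cauchy-Schwarz against the all-ones vector, obtained by summing `2xy≤x²+y²` over all ordered
  -- pairs of indices. Everything is doubled, and the factor two is removed at the very end.
  cauchy-schwarz : (f : Fin n → Carrier) → sum f * sum f ≤ fromℕ n * sum (λ i → f i * f i)
  cauchy-schwarz {n} f = x+x≤y+y⇒x≤y (begin
    sum f * sum f + sum f * sum f
      ≈⟨ +-cong (sum-*-sum f f) (sum-*-sum f f) ⟩
    sum (λ i → sum (λ j → f i * f j)) + sum (λ i → sum (λ j → f i * f j))
      ≈⟨ ∑-distrib-+ row row ⟨
    sum (λ i → sum (λ j → f i * f j) + sum (λ j → f i * f j))
      ≈⟨ sum-cong-≋ (λ i → ∑-distrib-+ (λ j → f i * f j) (λ j → f i * f j)) ⟨
    sum (λ i → sum (λ j → f i * f j + f i * f j))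
      ≤⟨ sum-mono-≤ (λ i → sum-mono-≤ (λ j → 2xy≤x²+y² (f i) (f j))) ⟩
    sum (λ i → sum (λ j → f i * f i + f j * f j))
      ≈⟨ sum-cong-≋ (λ i → trans (∑-distrib-+ {n} (λ _ → f i * f i) (λ j → f j * f j)) (+-congʳ (sum-const n _))) ⟩
    sum (λ i → fromℕ n * (f i * f i) + Q)
      ≈⟨ ∑-distrib-+ (λ i → fromℕ n * (f i * f i)) (λ _ → Q) ⟩
    sum (λ i → fromℕ n * (f i * f i)) + sum {n} (λ _ → Q)
      ≈⟨ +-cong (sym (*-distribˡ-sum (fromℕ n) (λ i → f i * f i))) (sum-const n Q) ⟩
    fromℕ n * Q + fromℕ n * Q ∎)
    where
    Q : Carrier
    Q = sum (λ i → f i * f i)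

    row : Fin n → Carrier
    row i = sum (λ j → f i * f j)

  -- Weighting the hypotheses by y k and adding each ordered pair (k , l) to its
  -- mirror image (l , k) leaves every product y k * y l at least once, and the
  -- diagonal twice.
  single-core-inequality : (y C : Fin n → Carrier) → (∀ k → 0# ≤ y k) →
    (∀ k → y k * sum (λ l → ⟦ does (C l ≤? C k) ⟧ y l) ≤ y k * C k) →
    sum (λ k → y k * y k) + sum y * sum y ≤ sum (λ k → y k * C k) + sum (λ k → y k * C k)
  single-core-inequality {n} y C 0≤y busy = begin
    sum (λ k → y k * y k) + sum y * sum y
      ≈⟨ +-cong (sum-cong-≋ (λ k → sym (sum-⟦≟⟧ k (λ l → y k * y l)))) (sum-*-sum y y) ⟩
    sum (λ k → sum (λ l → ⟦ does (k ≟ l) ⟧ (y k * y l))) + sum (λ k → sum (λ l → y k * y l))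
      ≈⟨ ∑∑-distrib-+ _ _ ⟨
    sum (λ k → sum (λ l → ⟦ does (k ≟ l) ⟧ (y k * y l) + y k * y l))
      ≤⟨ sum-mono-≤ (λ k → sum-mono-≤ (pair k)) ⟩
    sum (λ k → sum (λ l → a k l + a l k))
      ≈⟨ ∑∑-distrib-+ a (λ k l → a l k) ⟩
    sum (λ k → sum (a k)) + sum (λ k → sum (λ l → a l k))
      ≈⟨ +-congˡ (∑-comm (λ k l → a l k)) ⟩
    sum (λ k → sum (a k)) + sum (λ k → sum (a k))
      ≤⟨ +-mono-≤ a≤ a≤ ⟩
    sum (λ k → y k * C k) + sum (λ k → y k * C k) ∎
    where
    a : Fin n → Fin n → Carrier
    a k l = y k * ⟦ does (C l ≤? C k) ⟧ y l

    ∑∑-distrib-+ : (f g : Fin n → Fin n → Carrier) →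
      sum (λ k → sum (λ l → f k l + g k l)) ≈ sum (λ k → sum (f k)) + sum (λ k → sum (g k))
    ∑∑-distrib-+ f g = trans (sum-cong-≋ (λ k → ∑-distrib-+ (f k) (g k))) (∑-distrib-+ (λ k → sum (f k)) (λ k → sum (g k)))

    a-nonNegative : ∀ k l → 0# ≤ a k l
    a-nonNegative k l = *-nonNegative (0≤y k) (⟦⟧-nonNegative (does (C l ≤? C k)) (0≤y l))

    a-≤ : ∀ k l → C l ≤ C k → a k l ≈ y k * y l
    a-≤ k l p with C l ≤? C k
    ... | yes _ = refl
    ... | no ¬p = contradiction p ¬p

    pair : ∀ k l → ⟦ does (k ≟ l) ⟧ (y k * y l) + y k * y l ≤ a k l + a l k
    pair k l with k ≟ l
    ... | yes ≡.refl = ≤-reflexive (sym (+-cong (a-≤ k k ≤-refl) (a-≤ k k ≤-refl)))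
    ... | no _ with total (C l) (C k)
    ...   | inj₁ p = begin
            0# + y k * y l ≈⟨ +-comm _ _ ⟩
            y k * y l + 0# ≤⟨ +-mono-≤ (≤-reflexive (sym (a-≤ k l p))) (a-nonNegative l k) ⟩
            a k l + a l k  ∎
    ...   | inj₂ p = +-mono-≤ (a-nonNegative k l) (≤-reflexive (trans (*-comm _ _) (sym (a-≤ l k p))))

    a≤ : sum (λ k → sum (a k)) ≤ sum (λ k → y k * C k)
    a≤ = begin
      sum (λ k → sum (a k))
        ≈⟨ sum-cong-≋ (λ k → *-distribˡ-sum (y k) (λ l → ⟦ does (C l ≤? C k) ⟧ y l)) ⟨
      sum (λ k → y k * sum (λ l → ⟦ does (C l ≤? C k) ⟧ y l))
        ≤⟨ sum-mono-≤ busy ⟩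
      sum (λ k → y k * C k) ∎

  -- The single-core inequality is applied to each core and the results are added. Cauchy-Schwarz
  -- bounds the square of the total by `m` times the sum of the squared core totals. The diagonal
  -- sum `D` comes under the same factor because `m` is at least one.
  parallel-cores-inequality : ∀ {m} .{{_ : NonZero m}} (core : Fin n → Fin m) (x C : Fin n → Carrier) →
    (∀ k → 0# ≤ x k) →
    (∀ k → sum (λ l → ⟦ does (core l ≟ core k) ⟧ ⟦ does (C l ≤? C k) ⟧ x l) ≤ C k) →
    sum (λ k → x k * x k) + sum x * sum x ≤ fromℕ (2 ℕ.* m) * sum (λ k → x k * C k)
  parallel-cores-inequality {n} {m} core x C 0≤x busy = begin
    D + sum x * sum x
      ≈⟨ +-congˡ (*-cong (by-core x) (by-core x)) ⟩
    D + sum X * sum X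
      ≤⟨ +-mono-≤ D≤ (cauchy-schwarz X) ⟩
    fromℕ m * D + fromℕ m * sum (λ h → X h * X h)
      ≈⟨ distribˡ (fromℕ m) _ _ ⟨
    fromℕ m * (D + sum (λ h → X h * X h))
      ≈⟨ *-congˡ (+-congʳ (by-core (λ k → x k * x k))) ⟩
    fromℕ m * (sum (λ h → sum (λ k → at h k (x k * x k))) + sum (λ h → X h * X h))
      ≈⟨ *-congˡ (∑-distrib-+ _ (λ h → X h * X h)) ⟨
    fromℕ m * sum (λ h → sum (λ k → at h k (x k * x k)) + X h * X h)
      ≤⟨ *-monoˡ-≤ (fromℕ m) (fromℕ-nonNegative m) (sum-mono-≤ on-core) ⟩
    fromℕ m * sum (λ h → sum (λ k → at h k (x k * C k)) + sum (λ k → at h k (x k * C k)))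
      ≈⟨ *-congˡ (∑-distrib-+ _ (λ h → sum (λ k → at h k (x k * C k)))) ⟩
    fromℕ m * (sum (λ h → sum (λ k → at h k (x k * C k))) + sum (λ h → sum (λ k → at h k (x k * C k))))
      ≈⟨ *-congˡ (+-cong (by-core (λ k → x k * C k)) (by-core (λ k → x k * C k))) ⟨
    fromℕ m * (W + W)
      ≈⟨ solve 2 (λ m w → m :* (w :+ w) := (m :+ m) :* w) refl (fromℕ m) W ⟩
    (fromℕ m + fromℕ m) * W
      ≈⟨ *-congʳ (trans (fromℕ-+ m (m ℕ.+ 0)) (+-congˡ (trans (fromℕ-+ m 0) (+-identityʳ _)))) ⟨
    fromℕ (2 ℕ.* m) * W ∎
    where
    at : Fin m → Fin n → Carrier → Carrier
    at h k = ⟦ does (core k ≟ h) ⟧_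

    xₕ : Fin m → Fin n → Carrier
    xₕ h k = at h k (x k)

    X : Fin m → Carrier
    X h = sum (xₕ h)

    D W : Carrier
    D = sum (λ k → x k * x k)
    W = sum (λ k → x k * C k)

    by-core : (f : Fin n → Carrier) → sum f ≈ sum (λ h → sum (λ k → at h k (f k)))
    by-core f = trans (sum-cong-≋ (λ k → sym (sum-⟦≟⟧ (core k) (λ _ → f k)))) (∑-comm (λ k h → at h k (f k)))

    D≤ : D ≤ fromℕ m * D
    D≤ = begin
      D           ≈⟨ *-identityˡ D ⟨
      1# * D      ≤⟨ *-monoʳ-≤ D (sum-nonNegative (λ k → square-nonNegative (x k))) (1≤fromℕ m) ⟩
      fromℕ m * D ∎

    -- For a coflow on another core the factor `xₕ h k` is zero and nothing is claimed; this is why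
    -- the hypothesis of `single-core-inequality` is weighted.
    busy-on : ∀ h k → xₕ h k * sum (λ l → ⟦ does (C l ≤? C k) ⟧ xₕ h l) ≤ xₕ h k * C k
    busy-on h k with core k ≟ h
    ... | no _       = ≤-reflexive (trans (zeroˡ _) (sym (zeroˡ _)))
    ... | yes ≡.refl = *-monoˡ-≤ (x k) (0≤x k) (begin
      sum (λ l → ⟦ does (C l ≤? C k) ⟧ xₕ h l)
        ≈⟨ sum-cong-≋ (λ l → swap (does (C l ≤? C k)) (does (core l ≟ h))) ⟩
      sum (λ l → ⟦ does (core l ≟ h) ⟧ ⟦ does (C l ≤? C k) ⟧ x l)
        ≤⟨ busy k ⟩
      C k ∎)
      where
      swap : ∀ a b → ⟦ a ⟧ ⟦ b ⟧ z ≈ ⟦ b ⟧ ⟦ a ⟧ z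
      swap true  b     = refl
      swap false true  = refl
      swap false false = refl

    on-core : ∀ h → sum (λ k → at h k (x k * x k)) + X h * X h ≤
                    sum (λ k → at h k (x k * C k)) + sum (λ k → at h k (x k * C k))
    on-core h = begin
      sum (λ k → at h k (x k * x k)) + X h * X h
        ≈⟨ +-congʳ (sum-cong-≋ (λ k → ⟦⟧-square (does (core k ≟ h)) (x k))) ⟨
      sum (λ k → xₕ h k * xₕ h k) + X h * X h
        ≤⟨ single-core-inequality (xₕ h) C (λ k → ⟦⟧-nonNegative (does (core k ≟ h)) (0≤x k)) (busy-on h) ⟩
      sum (λ k → xₕ h k * C k) + sum (λ k → xₕ h k * C k)
        ≈⟨ +-cong yC yC ⟩
      sum (λ k → at h k (x k * C k)) + sum (λ k → at h k (x k * C k)) ∎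
      where
      yC : sum (λ k → xₕ h k * C k) ≈ sum (λ k → at h k (x k * C k))
      yC = sum-cong-≋ (λ k → ⟦⟧-*ʳ (does (core k ≟ h)) (x k) (C k))

-- Coflow instances released at time zero, and their port loads.

module CoflowProperties {c ℓ₁ ℓ₂} (F : OrderedField c ℓ₁ ℓ₂) (N m : ℕ) .{{_ : NonZero m}} where

  open OrderedFieldProperties F
  open ≤-Reasoning
  open CoflowScheduling F N m

  module _ (I : Instance) (released : ∀ k → Instance.release I k ≈ 0#) where

    open Instance I

    -- Lets each argument be given once for input and output ports. `load input` and `load output`
    -- unfold to `inputLoad` and `outputLoad`.
    data Side : Set where
      input output : Side

    flow : Side → Port → Port → Coflow I → Flow I
    flow input  p q k = p , q , k
    flow output p q k = q , p , k

    load : Side → Port → Coflow I → ℕ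
    load s p k = sumℕ (λ q → size I (flow s p q k))

    -- The LP speaks of loads of coflows, while capacities and backlogs are sums over single flows;
    -- this translates between them.
    load-by-flow : ∀ s p (b : Coflow I → Bool) →
      sum (λ k → ⟦ b k ⟧ fromℕ (load s p k)) ≈
      sum (λ q → sum (λ k → ⟦ b k ⟧ fromℕ (size I (flow s p q k))))
    load-by-flow s p b = trans
      (sum-cong-≋ (λ k → trans
        (⟦⟧-cong (b k) (fromℕ-sumℕ (λ q → size I (flow s p q k))))
        (⟦⟧-sum (b k) (λ q → fromℕ (size I (flow s p q k))))))
      (∑-comm (λ k q → ⟦ b k ⟧ fromℕ (size I (flow s p q k))))

    0<2m : NonZero (2 ℕ.* m)
    0<2m = ℕ.m*n≢0 2 m

    -- Completion times of a feasible schedule satisfy the LP constraints.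

    module _ (σ : Schedule I) (σ-feasible : Feasible I σ)
             (C : Coflow I → Carrier) (completion : ∀ k → IsCompletionTime I σ k (C k))
             where

      open Schedule σ
      open Feasible σ-feasible
      open module Completion k = IsCompletionTime (completion k)

      C≥0 : ∀ k → 0# ≤ C k
      C≥0 k = ≤-trans (≤-reflexive (sym (released k))) (afterRelease k)

      finished-flow : ∀ s p q k → sent (flow s p q k) (C k) ≈ fromℕ (size I (flow s p q k))
      finished-flow input  p q k = finished k p q
      finished-flow output p q k = finished k q p

      capacity : ∀ s h p {t u} → t ≤ u →
        sum (λ q → sum (λ k → ⟦ does (core k ≟ h) ⟧ sentBetween I σ t u (flow s p q k))) ≤ u - t
      capacity input  h p = inputCapacity h p
      capacity output h p = outputCapacity h p

      -- A coflow completed by time `t` has sent its whole load through the port since time zero,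
      -- any other coflow a non-negative amount, and together they respect the unit capacity.
      finished-load≤ : ∀ s h p t → 0# ≤ t →
        sum (λ k → ⟦ does (core k ≟ h) ⟧ ⟦ does (C k ≤? t) ⟧ fromℕ (load s p k)) ≤ t
      finished-load≤ s h p t 0≤t = begin
        sum (λ k → ⟦ does (core k ≟ h) ⟧ ⟦ does (C k ≤? t) ⟧ fromℕ (load s p k))
          ≈⟨ sum-cong-≋ (λ k → ⟦∧⟧ (does (core k ≟ h)) (does (C k ≤? t))) ⟩
        sum (λ k → ⟦ does (core k ≟ h) ∧ does (C k ≤? t) ⟧ fromℕ (load s p k))
          ≈⟨ load-by-flow s p (λ k → does (core k ≟ h) ∧ does (C k ≤? t)) ⟩
        sum (λ q → sum (λ k → ⟦ does (core k ≟ h) ∧ does (C k ≤? t) ⟧ fromℕ (size I (flow s p q k))))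
          ≤⟨ sum-mono-≤ (λ q → sum-mono-≤ (λ k → transmitted q k)) ⟩
        sum (λ q → sum (λ k → ⟦ does (core k ≟ h) ⟧ sentBetween I σ 0# t (flow s p q k)))
          ≤⟨ capacity s h p 0≤t ⟩
        t - 0#
          ≈⟨ x-0≈x t ⟩
        t ∎
        where
        ⟦∧⟧ : ∀ a b {x} → ⟦ a ⟧ ⟦ b ⟧ x ≈ ⟦ a ∧ b ⟧ x
        ⟦∧⟧ true  b = refl
        ⟦∧⟧ false b = refl

        transmitted : ∀ q k → ⟦ does (core k ≟ h) ∧ does (C k ≤? t) ⟧ fromℕ (size I (flow s p q k)) ≤
                              ⟦ does (core k ≟ h) ⟧ sentBetween I σ 0# t (flow s p q k)
        transmitted q k with core k ≟ h
        ... | no  _ = ≤-refl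
        ... | yes _ with C k ≤? t
        ...   | no  _   = x≤y⇒0≤y-x (monotone (flow s p q k) 0≤t)
        ...   | yes C≤t = begin
          fromℕ (size I (flow s p q k))          ≈⟨ finished-flow s p q k ⟨
          sent (flow s p q k) (C k)              ≤⟨ monotone (flow s p q k) C≤t ⟩
          sent (flow s p q k) t                  ≈⟨ x-0≈x _ ⟨
          -- Nothing is sent up to the release time, which is zero here.
          sent (flow s p q k) t - 0#             ≈⟨ +-congˡ (-‿cong (notBeforeRelease _ 0# (≤-reflexive (sym (released _))))) ⟨
          sentBetween I σ 0# t (flow s p q k)    ∎

      -- At time `C k` the finished load on the core of `k` contains the load of `k` itself.
      load≤C : ∀ s p k → fromℕ (load s p k) ≤ C k
      load≤C s p k = begin
        fromℕ (load s p k)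
          ≈⟨ reflexive (≡.cong₂ (λ a b → ⟦ a ⟧ ⟦ b ⟧ fromℕ (load s p k))
               (dec-true (core k ≟ core k) ≡.refl) (dec-true (C k ≤? C k) ≤-refl)) ⟨
        ⟦ does (core k ≟ core k) ⟧ ⟦ does (C k ≤? C k) ⟧ fromℕ (load s p k)
          ≤⟨ term≤sum (λ l → ⟦⟧-nonNegative (does (core l ≟ core k))
               (⟦⟧-nonNegative (does (C l ≤? C k)) (fromℕ-nonNegative (load s p l)))) k ⟩
        sum (λ l → ⟦ does (core l ≟ core k) ⟧ ⟦ does (C l ≤? C k) ⟧ fromℕ (load s p l))
          ≤⟨ finished-load≤ s (core k) p (C k) (C≥0 k) ⟩
        C k ∎

      release+load≤C : ∀ s p k → release k + fromℕ (load s p k) ≤ C k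
      release+load≤C s p k = ≤-trans
        (≤-reflexive (trans (+-congʳ (released k)) (+-identityˡ _))) (load≤C s p k)

      -- Coflows outside `S` are given load zero in `x`. The remaining hypothesis of
      -- `parallel-cores-inequality` is then `finished-load≤` at time `C k`.
      loadInequality : ∀ s p S → LoadInequality I (load s p) C S
      loadInequality s p S = begin
        fromℕ (2 ℕ.* m) ⁻¹ * (sumOver I S (λ k → L k * L k) + sumOver I S L * sumOver I S L)
          ≈⟨ *-congˡ (+-congʳ (sum-cong-≋ (λ k → ⟦⟧-square (lookup S k) (L k)))) ⟨
        fromℕ (2 ℕ.* m) ⁻¹ * (sum (λ k → x k * x k) + sum x * sum x)
          ≤⟨ *-monoˡ-≤ _ (⁻¹-nonNegative 2m≉0 (fromℕ-nonNegative (2 ℕ.* m)))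
               (parallel-cores-inequality core x C x≥0 busy) ⟩
        fromℕ (2 ℕ.* m) ⁻¹ * (fromℕ (2 ℕ.* m) * sum (λ k → x k * C k))
          ≈⟨ x⁻¹*[x*y]≈y 2m≉0 ⟩
        sum (λ k → x k * C k)
          ≈⟨ sum-cong-≋ (λ k → ⟦⟧-*ʳ (lookup S k) (L k) (C k)) ⟩
        sumOver I S (λ k → L k * C k) ∎
        where
        L x : Coflow I → Carrier
        L k = fromℕ (load s p k)
        x k = ⟦ lookup S k ⟧ L k

        2m≉0 : ¬ (fromℕ (2 ℕ.* m) ≈ 0#)
        2m≉0 = fromℕ≉0 (2 ℕ.* m) {{0<2m}}

        x≥0 : ∀ k → 0# ≤ x k
        x≥0 k = ⟦⟧-nonNegative (lookup S k) (fromℕ-nonNegative (load s p k))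

        busy : ∀ k → sum (λ l → ⟦ does (core l ≟ core k) ⟧ ⟦ does (C l ≤? C k) ⟧ x l) ≤ C k
        busy k = ≤-trans
          (sum-mono-≤ (λ l → ⟦⟧-mono-≤ (does (core l ≟ core k)) (⟦⟧-mono-≤ (does (C l ≤? C k))
            (⟦⟧-≤ (lookup S l) (fromℕ-nonNegative (load s p l))))))
          (finished-load≤ s (core k) p (C k) (C≥0 k))

      feasible⇒LPFeasible : LPFeasible I C
      feasible⇒LPFeasible = record
        { inputBound       = λ k i → release+load≤C input i k
        ; outputBound      = λ k j → release+load≤C output j k
        ; inputInequality  = loadInequality input
        ; outputInequality = loadInequality output
        }

    -- Prefix loads bounded by LP values.

    module _ (C̄ : Coflow I → Carrier) (C̄-feasible : LPFeasible I C̄) where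

      open LPFeasible C̄-feasible

      -- The set is defined by LP values instead of list positions, so ties with `k` are included
      -- and it contains every coflow listed up to `k`.
      prefix-load : Side → Port → Coflow I → Carrier
      prefix-load s p k = sum (λ l → ⟦ does (C̄ l ≤? C̄ k) ⟧ fromℕ (load s p l))

      LP-loadInequality : ∀ s p S → LoadInequality I (load s p) C̄ S
      LP-loadInequality input  = inputInequality
      LP-loadInequality output = outputInequality

      -- In the LP inequality for the prefix set `S`, the sum of squares on the left is dropped and
      -- each `C̄ l` on the right is raised to `C̄ k`. One factor `X` then cancels.
      prefix-load≤ : ∀ s p k → 0# ≤ C̄ k → prefix-load s p k ≤ fromℕ (2 ℕ.* m) * C̄ k
      prefix-load≤ s p k 0≤C̄ with prefix-load s p k ≈? 0#
      -- A zero load cannot be cancelled, so this case rests on `0# ≤ C̄ k`.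
      ... | yes X≈0 = ≤-trans (≤-reflexive X≈0) (*-nonNegative (fromℕ-nonNegative (2 ℕ.* m)) 0≤C̄)
      ... | no  X≉0 = *-cancelˡ-≤ X≉0 X≥0 (begin
        X * X
          ≈⟨ *-cong prefix-sum prefix-sum ⟨
        sumOver I S L * sumOver I S L
          ≤⟨ x≤y+x D≥0 ⟩
        D + sumOver I S L * sumOver I S L
          ≈⟨ x*[x⁻¹*y]≈y (fromℕ≉0 (2 ℕ.* m) {{0<2m}}) ⟨
        K * (K ⁻¹ * (D + sumOver I S L * sumOver I S L))
          ≤⟨ *-monoˡ-≤ K K≥0 (LP-loadInequality s p S) ⟩
        K * sumOver I S (λ l → L l * C̄ l)
          ≤⟨ *-monoˡ-≤ K K≥0 (sum-mono-≤ (λ l → ⟦⟧-*-mono-≤ (lookup S l) (S-prefix l) (fromℕ-nonNegative (load s p l)))) ⟩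
        K * sum (λ l → ⟦ lookup S l ⟧ L l * C̄ k)
          ≈⟨ *-congˡ (*-distribʳ-sum (C̄ k) (λ l → ⟦ lookup S l ⟧ L l)) ⟨
        K * (sumOver I S L * C̄ k)
          ≈⟨ *-congˡ (*-congʳ prefix-sum) ⟩
        K * (X * C̄ k)
          ≈⟨ *-left-comm K X (C̄ k) ⟩
        X * (K * C̄ k) ∎)
        where
        S : Subset n
        S = tabulate (λ l → does (C̄ l ≤? C̄ k))

        L : Coflow I → Carrier
        L l = fromℕ (load s p l)

        K X D : Carrier
        K = fromℕ (2 ℕ.* m)
        X = prefix-load s p k
        D = sumOver I S (λ l → L l * L l)

        lookup-S : ∀ l → lookup S l ≡ does (C̄ l ≤? C̄ k)
        lookup-S = lookup∘tabulate (λ l → does (C̄ l ≤? C̄ k))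

        S-prefix : ∀ l → lookup S l ≡ true → C̄ l ≤ C̄ k
        S-prefix l l∈S with C̄ l ≤? C̄ k | ≡.trans (≡.sym (lookup-S l)) l∈S
        ... | yes C̄l≤C̄k | _ = C̄l≤C̄k

        prefix-sum : sumOver I S L ≈ X
        prefix-sum = sum-cong-≋ (λ l → reflexive (≡.cong (λ b → ⟦ b ⟧ L l) (lookup-S l)))

        K≥0 : 0# ≤ K
        K≥0 = fromℕ-nonNegative (2 ℕ.* m)

        D≥0 : 0# ≤ D
        D≥0 = sum-nonNegative (λ l → ⟦⟧-nonNegative (lookup S l) (square-nonNegative (L l)))

        X≥0 : 0# ≤ X
        X≥0 = sum-nonNegative (λ l → ⟦⟧-nonNegative (does (C̄ l ≤? C̄ k)) (fromℕ-nonNegative (load s p l)))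

    -- The greedy scan for active flows.

    allPairs : ∀ {a r} {A : Set a} {R : A → A → Set r} → (∀ x y → R x y) → ∀ xs → AllPairs R xs
    allPairs r []       = []
    allPairs r (x ∷ xs) = All.universal (r x) xs ∷ allPairs r xs

    ∈-scan⁻ : ∀ active fs {f} → f ∈ scan I active fs → f ∈ active ⊎ f ∈ fs
    ∈-scan⁻ active []       f∈ = inj₁ f∈
    ∈-scan⁻ active (g ∷ fs) f∈ with any? (conflict? I g) active
    ... | yes _ with ∈-scan⁻ active fs f∈
    ...   | inj₁ p = inj₁ p
    ...   | inj₂ p = inj₂ (there p)
    ∈-scan⁻ active (g ∷ fs) f∈ | no _ with ∈-scan⁻ (g ∷ active) fs f∈
    ...   | inj₁ (here p)  = inj₂ (here p)
    ...   | inj₁ (there p) = inj₁ p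
    ...   | inj₂ p         = inj₂ (there p)

    ∈-scan⁺ : ∀ active fs {f} → f ∈ active → f ∈ scan I active fs
    ∈-scan⁺ active []       f∈ = f∈
    ∈-scan⁺ active (g ∷ fs) f∈ with any? (conflict? I g) active
    ... | yes _ = ∈-scan⁺ active fs f∈
    ... | no  _ = ∈-scan⁺ (g ∷ active) fs (there f∈)

    -- A scanned flow is either made active, and conflicts with itself, or rejected because of a
    -- flow made active earlier, hence listed before it. The alternative `g ∈ active` carries the
    -- induction over the accumulator.
    scan-blocks : ∀ {ℓ} {_≼_ : Flow I → Flow I → Set ℓ} → (∀ {f} → f ≼ f) →
      ∀ active fs → AllPairs _≼_ fs → ∀ {f} → f ∈ fs →
      ∃[ g ] g ∈ scan I active fs × Conflict I f g × (g ∈ active ⊎ g ≼ f)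
    scan-blocks ≼-refl active (g ∷ fs) (g≼ ∷ fs!) {f} f∈ with any? (conflict? I g) active
    scan-blocks ≼-refl active (g ∷ fs) (g≼ ∷ fs!) (here ≡.refl) | yes any =
      let (g′ , g′∈ , conflict) = find any in g′ , ∈-scan⁺ active fs g′∈ , conflict , inj₁ g′∈
    scan-blocks ≼-refl active (g ∷ fs) (g≼ ∷ fs!) (there f∈)    | yes _ = scan-blocks ≼-refl active fs fs! f∈
    scan-blocks ≼-refl active (g ∷ fs) (g≼ ∷ fs!) (here ≡.refl) | no _ =
      g , ∈-scan⁺ (g ∷ active) fs (here ≡.refl) , inj₁ ≡.refl , inj₂ ≼-refl
    scan-blocks ≼-refl active (g ∷ fs) (g≼ ∷ fs!) (there f∈)    | no _
      with scan-blocks ≼-refl (g ∷ active) fs fs! f∈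
    -- The blocking flow is the head that has just been made active, and the head precedes all of
    -- `fs`.
    ... | g′ , g′∈ , conflict , inj₁ (here ≡.refl) = g′ , g′∈ , conflict , inj₂ (All.lookup g≼ f∈)
    ... | g′ , g′∈ , conflict , inj₁ (there q)     = g′ , g′∈ , conflict , inj₁ q
    ... | g′ , g′∈ , conflict , inj₂ q             = g′ , g′∈ , conflict , inj₂ q

    -- The backlog of a flow as a potential function.

    module _ (C̄ : Coflow I → Carrier) where

      _≼_ : Flow I → Flow I → Set ℓ₂
      f ≼ g = C̄ (coflow I f) ≤ C̄ (coflow I g)

      -- The sum ranges over the coflows of all cores, so that for full flow sizes it is the
      -- `prefix-load` bounded by the LP.
      ahead : Side → Port → Coflow I → (Flow I → Carrier) → Carrier
      ahead s p k rem = sum (λ q → sum (λ l → ⟦ does (C̄ l ≤? C̄ k) ⟧ rem (flow s p q l)))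

      -- An upper bound for the time until the flow is finished. Flows joining the same two ports,
      -- including the flow itself, are counted twice.
      backlog : Flow I → (Flow I → Carrier) → Carrier
      backlog (i , j , k) rem = ahead input i k rem + ahead output j k rem

      backlog-nonNegative : ∀ f {rem} → (∀ g → 0# ≤ rem g) → 0# ≤ backlog f rem
      backlog-nonNegative (i , j , k) {rem} rem≥0 = +-nonNegative (ahead≥0 input i) (ahead≥0 output j)
        where
        ahead≥0 : ∀ s p → 0# ≤ ahead s p k rem
        ahead≥0 s p = sum-nonNegative (λ q → sum-nonNegative (λ l →
          ⟦⟧-nonNegative (does (C̄ l ≤? C̄ k)) (rem≥0 (flow s p q l))))

      ahead-mono : ∀ s p k {rem rem′} → (∀ g → rem′ g ≤ rem g) → ahead s p k rem′ ≤ ahead s p k rem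
      ahead-mono s p k rem′≤rem = sum-mono-≤ (λ q → sum-mono-≤ (λ l →
        ⟦⟧-mono-≤ (does (C̄ l ≤? C̄ k)) (rem′≤rem (flow s p q l))))

      ahead-drop : ∀ s p k {Δ rem rem′} → (∀ g → rem′ g ≤ rem g) →
        ∀ q l → C̄ l ≤ C̄ k → rem′ (flow s p q l) + Δ ≤ rem (flow s p q l) →
        ahead s p k rem′ + Δ ≤ ahead s p k rem
      ahead-drop s p k {Δ} {rem} {rem′} rem′≤rem q l C̄l≤C̄k drop = sum-gain
        (λ q → sum-mono-≤ (λ l → ⟦⟧-mono-≤ (does (C̄ l ≤? C̄ k)) (rem′≤rem (flow s p q l))))
        q
        (sum-gain (λ l → ⟦⟧-mono-≤ (does (C̄ l ≤? C̄ k)) (rem′≤rem (flow s p q l))) l guarded-drop)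
        where
        guarded-drop : ⟦ does (C̄ l ≤? C̄ k) ⟧ rem′ (flow s p q l) + Δ ≤ ⟦ does (C̄ l ≤? C̄ k) ⟧ rem (flow s p q l)
        guarded-drop rewrite dec-true (C̄ l ≤? C̄ k) C̄l≤C̄k = drop

      -- The port shared by `f` and `g` decides which of the two parts of the backlog loses `Δ`; the
      -- other part does not grow.
      backlog-drop : ∀ f g {Δ rem rem′} → (∀ g → rem′ g ≤ rem g) →
        Conflict I f g → g ≼ f → rem′ g + Δ ≤ rem g → backlog f rem′ + Δ ≤ backlog f rem
      backlog-drop (i , j , k) (i , j′ , l) {Δ} {rem} {rem′} rem′≤rem (inj₁ ≡.refl) g≼f drop = begin
        ahead input i k rem′ + ahead output j k rem′ + Δ
          ≈⟨ trans (+-assoc _ _ Δ) (trans (+-congˡ (+-comm _ Δ)) (sym (+-assoc _ Δ _))) ⟩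
        ahead input i k rem′ + Δ + ahead output j k rem′
          ≤⟨ +-mono-≤ (ahead-drop input i k rem′≤rem j′ l g≼f drop) (ahead-mono output j k rem′≤rem) ⟩
        ahead input i k rem + ahead output j k rem ∎
      backlog-drop (i , j , k) (i′ , j , l) {Δ} {rem} {rem′} rem′≤rem (inj₂ ≡.refl) g≼f drop = begin
        ahead input i k rem′ + ahead output j k rem′ + Δ
          ≈⟨ +-assoc _ _ Δ ⟩
        ahead input i k rem′ + (ahead output j k rem′ + Δ)
          ≤⟨ +-mono-≤ (ahead-mono input i k rem′≤rem) (ahead-drop output j k rem′≤rem i′ l g≼f drop) ⟩
        ahead input i k rem + ahead output j k rem ∎

    -- Runs of the list scheduling on one core.

    module _ (C̄ : Coflow I → Carrier) (core : Coflow I → Core)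
             (order : List (Coflow I)) (order-↭ : order ↭ List.allFin n)
             (sorted : AllPairs (λ k l → C̄ k ≤ C̄ l) order) (h : Core) where

      open Transmission I core order h
      open DecMembership (_≟-flow_ I) using (_∈?_)

      ∈-listing : ∀ a f → f ∈ listing a
      ∈-listing (arr , arr-↭) (i , j , k) = ∈-concatMap⁺ _ (lose
        (∈-resp-↭ (↭-sym order-↭) (∈-allFin k))
        (∈-map⁺ _ (∈-resp-↭ (↭-sym (arr-↭ k)) (∈-cartesianProduct⁺ (∈-allFin i) (∈-allFin j)))))

      listing-sorted : ∀ a → AllPairs (_≼_ C̄) (listing a)
      listing-sorted (arr , _) = AllPairs.concat⁺
        -- Flows of one coflow are all tied, so any arrangement of them is sorted.
        (All.map⁺ (All.universal (λ k → AllPairs.map⁺ (allPairs (λ _ _ → ≤-refl) (arr k))) order))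
        (AllPairs.map⁺ (AllPairs.map (λ p → All.map⁺ (All.universal (λ _ → All.map⁺ (All.universal (λ _ → p) _)) _)) sorted))

      transmit-∈ : ∀ Δ {A} rem {f} → f ∈ A → transmit Δ A rem f ≡ rem f - Δ
      transmit-∈ Δ {A} rem {f} f∈A rewrite dec-true (f ∈? A) f∈A = ≡.refl

      transmit-∉ : ∀ Δ {A} rem {f} → ¬ (f ∈ A) → transmit Δ A rem f ≡ rem f
      transmit-∉ Δ {A} rem {f} f∉A rewrite dec-false (f ∈? A) f∉A = ≡.refl

      ∈-activate⁻ : ∀ a t rem {f} → f ∈ activate a t rem → 0# < rem f
      ∈-activate⁻ a t rem f∈ with ∈-scan⁻ [] _ f∈
      ... | inj₂ f∈filter = proj₂ (proj₂ (proj₂ (∈-filter⁻ _ {xs = listing a} f∈filter)))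

      empty⇒∉-activate : ∀ a t rem {f} → rem f ≈ 0# → ¬ (f ∈ activate a t rem)
      empty⇒∉-activate a t rem rem≈0 f∈ = proj₂ (∈-activate⁻ a t rem f∈) (sym rem≈0)

      -- Only flows with a positive remainder are activated, so a remainder of zero stays zero to
      -- the end of the run.
      sentInRun-empty : ∀ {t rem} (r : Run t rem) f s → rem f ≈ 0# → sentInRun r f s ≈ 0#
      sentInRun-empty (done _) f s rem≈0 = refl
      sentInRun-empty {t} {rem} (step a t′ _ r) f s rem≈0
        with f∉A ← empty⇒∉-activate a t rem rem≈0
        rewrite dec-false (f ∈? activate a t rem) f∉A
        = trans (+-identityˡ _) (sentInRun-empty r f s
            (trans (reflexive (transmit-∉ (t′ - t) rem f∉A)) rem≈0))

      elapsed-all : ∀ {t t′ s} → t ≤ t′ → t′ ≤ s → elapsed t t′ s ≈ t′ - t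
      elapsed-all {t} {t′} {s} t≤t′ t′≤s with s ≤? t
      -- Here `t`, `t′` and `s` coincide, so the value zero of `elapsed` is the length of the step.
      ... | yes s≤t = sym (trans (+-congʳ (antisym (≤-trans t′≤s s≤t) t≤t′)) (-‿inverseʳ t))
      ... | no  _ with s ≤? t′
      ...   | yes s≤t′ = +-congʳ (antisym s≤t′ t′≤s)
      ...   | no  _    = refl

      module Step {t rem} (0≤t : 0# ≤ t) (rem≥0 : ∀ g → 0# ≤ rem g) (a : Arrangement) (t′ : Time)
                  (next : NextEvent t rem (activate a t rem) t′) where

        open NextEvent next

        A : List (Flow I)
        A = activate a t rem

        Δ : Carrier
        Δ = t′ - t

        rem′ : Flow I → Carrier
        rem′ = transmit Δ A rem

        t≤t′ : t ≤ t′
        t≤t′ with event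
        ... | completion f f∈A t′≈ = ≤-trans (x≤x+y (rem≥0 f)) (≤-reflexive (sym t′≈))
        ... | arrival f _ _ t<r t′≈ = ≤-trans (proj₁ t<r) (≤-reflexive (sym t′≈))

        Δ≥0 : 0# ≤ Δ
        Δ≥0 = x≤y⇒0≤y-x t≤t′

        -- The completion of an active flow is itself an event, so the next event does not come
        -- after it. This keeps remainders non-negative.
        Δ≤rem : ∀ {g} → g ∈ A → Δ ≤ rem g
        Δ≤rem {g} g∈A = +-cancelʳ-≤ t (begin
          t′ - t + t ≈⟨ x-y+y≈x t′ t ⟩
          t′         ≤⟨ first _ (completion g g∈A refl) ⟩
          t + rem g  ≈⟨ +-comm t (rem g) ⟩
          rem g + t  ∎)

        rem′-drop : ∀ {g} → g ∈ A → rem′ g + Δ ≈ rem g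
        rem′-drop {g} g∈A = trans (+-congʳ (reflexive (transmit-∈ Δ rem g∈A))) (x-y+y≈x (rem g) Δ)

        rem′≤rem : ∀ g → rem′ g ≤ rem g
        rem′≤rem g with g ∈? A
        ... | yes g∈A = ≤-trans (x≤x+y Δ≥0) (≤-reflexive (x-y+y≈x (rem g) Δ))
        ... | no  g∉A = ≤-refl

        rem′≥0 : ∀ g → 0# ≤ rem′ g
        rem′≥0 g with g ∈? A
        ... | yes g∈A = x≤y⇒0≤y-x (Δ≤rem g∈A)
        ... | no  g∉A = rem≥0 g

        0≤t′ : 0# ≤ t′
        0≤t′ = ≤-trans 0≤t t≤t′

        -- With all releases at zero, an unfinished `f` on this core is scanned. Some active flow
        -- `g` therefore conflicts with it and has `g ≼ f`. It is transmitted throughout the step,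
        -- so the backlog falls by at least the time that passes.
        t′+backlog≤ : ∀ f → core (coflow I f) ≡ h → ¬ (rem f ≈ 0#) → t′ + backlog C̄ f rem′ ≤ t + backlog C̄ f rem
        t′+backlog≤ f on-h rem≉0
          with scan-blocks {_≼_ = _≼_ C̄} ≤-refl [] _ (AllPairs.filter⁺ _ (listing-sorted a))
                 (∈-filter⁺ (λ g → (core (coflow I g) ≟ h) ×-dec ((release (coflow I g) ≤? t) ×-dec (0# <? rem g)))
                   (∈-listing a f) (on-h , ≤-trans (≤-reflexive (released _)) 0≤t , rem≥0 f , rem≉0 ∘ sym))
        -- The scan starts with no active flows, which excludes `g ∈ active`.
        ... | g , g∈A , conflict , inj₂ g≼f = begin
          t′ + backlog C̄ f rem′        ≈⟨ +-congʳ (y+[x-y]≈x t′ t) ⟨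
          t + Δ + backlog C̄ f rem′     ≈⟨ trans (+-assoc t Δ _) (+-congˡ (+-comm Δ _)) ⟩
          t + (backlog C̄ f rem′ + Δ)   ≤⟨ +-monoʳ-≤ t (backlog-drop C̄ f g rem′≤rem conflict g≼f (≤-reflexive (rem′-drop g∈A))) ⟩
          t + backlog C̄ f rem          ∎

      -- Induction on the run: while `f` is unfinished, `t + backlog C̄ f rem` does not increase, so
      -- the bound by `s` passes to the next event.
      sentInRun-complete : ∀ {t rem} (r : Run t rem) → 0# ≤ t → (∀ g → 0# ≤ rem g) →
        ∀ f → core (coflow I f) ≡ h → ∀ s → t + backlog C̄ f rem ≤ s → sentInRun r f s ≈ rem f
      sentInRun-complete (done rem≈0) 0≤t rem≥0 f on-h s late = sym (rem≈0 f on-h)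
      sentInRun-complete {t} {rem} r@(step a t′ next run) 0≤t rem≥0 f on-h s late with rem f ≈? 0#
      -- Once `f` is finished its ports may fall idle and the bound may fail later, but no more of
      -- `f` is sent.
      ... | yes rem≈0 = trans (sentInRun-empty r f s rem≈0) (sym rem≈0)
      ... | no  rem≉0 = main
        where
        open Step 0≤t rem≥0 a t′ next

        late′ : t′ + backlog C̄ f rem′ ≤ s
        late′ = ≤-trans (t′+backlog≤ f on-h rem≉0) late

        later : sentInRun run f s ≈ rem′ f
        later = sentInRun-complete run 0≤t′ rem′≥0 f on-h s late′

        t′≤s : t′ ≤ s
        -- As the backlog is non-negative, the whole step lies before `s` and counts in full.
        t′≤s = ≤-trans (x≤x+y (backlog-nonNegative C̄ f rem′≥0)) late′

        main : sentInRun r f s ≈ rem f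
        main with f ∈? A
        ... | yes f∈A = begin-equality
          elapsed t t′ s + sentInRun run f s ≈⟨ +-cong (elapsed-all t≤t′ t′≤s) later ⟩
          Δ + rem′ f                         ≈⟨ +-comm Δ (rem′ f) ⟩
          rem′ f + Δ                         ≈⟨ rem′-drop f∈A ⟩
          rem f                              ∎
        ... | no  f∉A = begin-equality
          0# + sentInRun run f s ≈⟨ +-identityˡ _ ⟩
          sentInRun run f s      ≈⟨ later ⟩
          rem′ f                 ≈⟨ reflexive (transmit-∉ Δ rem f∉A) ⟩
          rem f                  ∎

      sentOnCore-complete : (r : CoreRun) → ∀ f → core (coflow I f) ≡ h →
        ∀ s → backlog C̄ f (λ g → fromℕ (size I g)) ≤ s → sentOnCore r f s ≈ fromℕ (size I f)
      sentOnCore-complete (idle empty) f on-h s late = contradiction on-h (empty _)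
      sentOnCore-complete (start t₀ (k , _ , t₀≈r) _ run) f on-h s late =
        sentInRun-complete run (≤-reflexive (sym t₀≈0)) (λ g → fromℕ-nonNegative (size I g)) f on-h s
          (≤-trans (≤-reflexive (trans (+-congʳ t₀≈0) (+-identityˡ _))) late)
        where
        t₀≈0 : t₀ ≈ 0#
        t₀≈0 = trans t₀≈r (released k)

    -- Comparison of the algorithm with an arbitrary feasible schedule.

    module _ (E : Execution I) (C̃ : Coflow I → Carrier)
             (completion : ∀ k → IsCompletionTime I (Execution.schedule E) k (C̃ k)) where

      open Execution E
      open LPOptimal C̄-optimal
      open module AlgorithmCompletion k = IsCompletionTime (completion k)

      -- By time `T` the initial backlog of each flow of `k` has elapsed, and `earliest` turns this
      -- into a bound on `C̃ k`. The port supplies an LP constraint that makes `C̄ k` non-negative.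
      completion≤ : Port → ∀ k → C̃ k ≤ fromℕ (4 ℕ.* m) * C̄ k
      completion≤ p k = earliest k T (≤-trans (≤-reflexive (released k)) T≥0) (λ i j →
        sentOnCore-complete C̄ core order order-↭ sorted (core k) (runs (core k)) (i , j , k) ≡.refl T (backlog≤T i j))
        where
        T : Carrier
        T = fromℕ (4 ℕ.* m) * C̄ k

        C̄≥0 : 0# ≤ C̄ k
        C̄≥0 = begin
          0#                                 ≤⟨ +-nonNegative (release≥0 k) (fromℕ-nonNegative (load input p k)) ⟩
          release k + fromℕ (load input p k) ≤⟨ LPFeasible.inputBound feasible k p ⟩
          C̄ k                                ∎

        T≥0 : 0# ≤ T
        T≥0 = *-nonNegative (fromℕ-nonNegative (4 ℕ.* m)) C̄≥0

        ahead≤ : ∀ s q → ahead C̄ s q k (λ g → fromℕ (size I g)) ≤ fromℕ (2 ℕ.* m) * C̄ k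
        ahead≤ s q = ≤-trans
          (≤-reflexive (sym (load-by-flow s q (λ l → does (C̄ l ≤? C̄ k)))))
          (prefix-load≤ C̄ feasible s q k C̄≥0)

        backlog≤T : ∀ i j → backlog C̄ (i , j , k) (λ g → fromℕ (size I g)) ≤ T
        backlog≤T i j = begin
          -- Each of the two ports contributes `2 * m` times `C̄ k`, whence the factor `4 * m`.
          _ ≤⟨ +-mono-≤ (ahead≤ input i) (ahead≤ output j) ⟩
          fromℕ (2 ℕ.* m) * C̄ k + fromℕ (2 ℕ.* m) * C̄ k ≈⟨ distribʳ (C̄ k) _ _ ⟨
          (fromℕ (2 ℕ.* m) + fromℕ (2 ℕ.* m)) * C̄ k     ≈⟨ *-congʳ (fromℕ-+ (2 ℕ.* m) (2 ℕ.* m)) ⟨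
          fromℕ (2 ℕ.* m ℕ.+ 2 ℕ.* m) * C̄ k             ≡⟨ ≡.cong (λ a → fromℕ a * C̄ k) (ℕ.*-distribʳ-+ m 2 2) ⟨
          T                                             ∎

      module _ (σ : Schedule I) (σ-feasible : Feasible I σ)
               (C : Coflow I → Carrier) (σ-completion : ∀ k → IsCompletionTime I σ k (C k)) where

        cost≤ : Port → cost I C̃ ≤ fromℕ (4 ℕ.* m) * cost I C
        cost≤ p = begin
          cost I C̃
            ≤⟨ sum-mono-≤ (λ k → *-monoˡ-≤ (weight k) (proj₁ (weight>0 k)) (completion≤ p k)) ⟩
          sum (λ k → weight k * (fromℕ (4 ℕ.* m) * C̄ k))
            ≈⟨ sum-cong-≋ (λ k → *-left-comm (weight k) (fromℕ (4 ℕ.* m)) (C̄ k)) ⟩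
          sum (λ k → fromℕ (4 ℕ.* m) * (weight k * C̄ k))
            ≈⟨ *-distribˡ-sum (fromℕ (4 ℕ.* m)) (λ k → weight k * C̄ k) ⟨
          fromℕ (4 ℕ.* m) * cost I C̄
            ≤⟨ *-monoˡ-≤ _ (fromℕ-nonNegative (4 ℕ.* m))
                 (optimal C (feasible⇒LPFeasible σ σ-feasible C σ-completion)) ⟩
          fromℕ (4 ℕ.* m) * cost I C ∎

        -- Without ports the LP does not bound C̄ from below.
        cost≤-no-ports : ¬ Port → cost I C̃ ≤ fromℕ (4 ℕ.* m) * cost I C
        cost≤-no-ports no-port = begin
          cost I C̃
            ≤⟨ sum-mono-≤ (λ k → *-monoˡ-≤ (weight k) (proj₁ (weight>0 k)) (C̃≤C k)) ⟩
          cost I C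
            ≈⟨ *-identityˡ _ ⟨
          1# * cost I C
            ≤⟨ *-monoʳ-≤ _ cost≥0 (1≤fromℕ (4 ℕ.* m) {{ℕ.m*n≢0 4 m}}) ⟩
          fromℕ (4 ℕ.* m) * cost I C ∎
          where
          C̃≤C : ∀ k → C̃ k ≤ C k
          -- With no ports there are no flows, and `Finished` holds vacuously at the release time.
          C̃≤C k = ≤-trans (earliest k (release k) ≤-refl (λ i → contradiction i no-port))
                          (IsCompletionTime.afterRelease (σ-completion k))

          cost≥0 : 0# ≤ cost I C
          cost≥0 = sum-nonNegative (λ k → *-nonNegative (proj₁ (weight>0 k)) (C≥0 σ σ-feasible C σ-completion k))

theorem4p6 :
    ∀ {c ℓ₁ ℓ₂} (F : OrderedField c ℓ₁ ℓ₂) (N m : ℕ) .{{_ : NonZero m}} →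
    let open OrderedField F
        open CoflowScheduling F N m in
    (I : Instance) → let open Instance I in
    (∀ k → release k ≈ 0#) →
    (E : Execution I) (C̃ : Fin n → Carrier) →
    (∀ k → IsCompletionTime I (Execution.schedule E) k (C̃ k)) →
    (σ : Schedule I) → Feasible I σ →
    (C : Fin n → Carrier) → (∀ k → IsCompletionTime I σ k (C k)) →
    cost I C̃ ≤ fromℕ (4 *ℕ m) * cost I C
theorem4p6 F zero m I released E C̃ completion σ σ-feasible C σ-completion =
  CoflowProperties.cost≤-no-ports F zero m I released E C̃ completion σ σ-feasible C σ-completion (λ ())
theorem4p6 F (suc N) m I released E C̃ completion σ σ-feasible C σ-completion =
  CoflowProperties.cost≤ F (suc N) m I released E C̃ completion σ σ-feasible C σ-completion zero
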